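{- Let $\mathbb{Z}/2[t]$ be the polynomial ring over the field with two elements, and define $C_n\in\mathbb{Z}/2[t]$ for $n\ge 0$ by $C_0=0$, $C_1=1$, $C_2=t$, $C_3=t^2$ and $$C_{n+4}=C_{n+3}+(t^4+t^3+t^2+t)\,C_n+t^n(t^2+t)\qquad(n\ge 0).$$ Then for every integer $m\ge 0$, $C_{4m}$ is a $\mathbb{Z}/2$-linear combination of the $C_k$ with $k<4m$. -}

module Defs where

open import Data.Bool using (Bool; true; false; _xor_; _∧_)
open import Data.List using (List; []; _∷_; map; replicate; _++_)
open import Data.Nat using (ℕ; zero; suc)
open import Relation.Binary.PropositionalEquality using (_≡_)

-- Polynomials over Z/2 = Bool (with xor as +, ∧ as *), as coefficient
-- lists, lowest degree first.  Trailing zeros are allowed; polynomials are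
-- compared coefficientwise via _≈ₚ_.
Poly : Set
Poly = List Bool

infixl 6 _⊕_
infixl 7 _⊗_

_⊕_ : Poly → Poly → Poly
[] ⊕ q = q
(a ∷ p) ⊕ [] = a ∷ p
(a ∷ p) ⊕ (b ∷ q) = (a xor b) ∷ (p ⊕ q)

scale : Bool → Poly → Poly
scale b p = map (b ∧_) p

_⊗_ : Poly → Poly → Poly
[] ⊗ q = []
(a ∷ p) ⊗ q = scale a q ⊕ (false ∷ (p ⊗ q))

coeff : Poly → ℕ → Bool
coeff [] i = false
coeff (a ∷ p) zero = a
coeff (a ∷ p) (suc i) = coeff p i

_≈ₚ_ : Poly → Poly → Set
p ≈ₚ q = ∀ i → coeff p i ≡ coeff q i

tpow : ℕ → Poly
tpow n = replicate n false ++ (true ∷ [])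

Q : Poly
Q = false ∷ true ∷ true ∷ true ∷ true ∷ []

R : Poly
R = false ∷ true ∷ true ∷ []

C : ℕ → Poly
C zero = []
C (suc zero) = true ∷ []
C (suc (suc zero)) = false ∷ true ∷ []
C (suc (suc (suc zero))) = false ∷ false ∷ true ∷ []
C (suc (suc (suc (suc n)))) = C (suc (suc (suc n))) ⊕ Q ⊗ C n ⊕ tpow n ⊗ R

linComb : (ℕ → Bool) → ℕ → Poly
linComb c zero = []
linComb c (suc n) = linComb c n ⊕ scale (c n) (C n)

{-# OPTIONS --safe #-}
-- Let T be the linear map t ^ k ↦ C k and put s = t + t².  With v = t⁴ + t³
-- the recurrence says T (v f) = Q T f + s f, and Q = v + s.  Together with the
-- relation s⁴ = s v + v² this gives, for E n = T (sⁿ),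
--   E (n + 4) = Q E (n + 1) + Q² E n.
-- As E 0 = E 2 = 0, E 1 = 1 + t and E 3 = Q (1 + t), it follows that
-- E (2 m + 1) is (1 + t) Q^m plus lower terms (1 + t) Q^j (j < m), while
-- E (2 m) consists of such lower terms only.  So E (2 m) is a combination of
-- the E (2 j + 1) with j < m.  Since E n is C (2 n) plus a combination of the
-- C k with k < 2 n, solving for C (4 m) gives the theorem.
module Submission where

open import Defs
open import Algebra.Bundles using (AbelianGroup)
open import Algebra.Structures using (IsAbelianGroup)
open import Data.Bool using (Bool; true; false; _xor_; _∧_)
open import Data.Bool.Properties
  using (xor-assoc; xor-comm; xor-same; ∧-zeroʳ; ∧-distribˡ-xor; ∧-distribʳ-xor)
open import Data.List using ([]; _∷_)
open import Data.Nat using (ℕ; zero; suc; _+_; _*_; _<_; _≤_; s≤s; _≡ᵇ_)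
open import Data.Nat.Properties
  using (+-identityʳ; +-suc; *-assoc; *-comm; ≤-refl; ≤-trans; m≤n⇒m≤1+n;
         m≤n⇒m<n∨m≡n; *-monoˡ-≤)
open import Data.Product using (∃; _,_)
open import Data.Sum using (inj₁; inj₂)
open import Level using (0ℓ)
open import Relation.Binary.PropositionalEquality
  using (_≡_; refl; sym; trans; cong; cong₂; subst)

-- Unlike the function type _≈ₚ_, a record lets Agda infer p and q.
infix 4 _≋_
record _≋_ (p q : Poly) : Set where
  constructor coeffs
  field at : p ≈ₚ q
open _≋_

-- Coefficientwise arithmetic: addition, scaling, multiplication.

coeff-⊕ : ∀ p q i → coeff (p ⊕ q) i ≡ coeff p i xor coeff q i
coeff-⊕ [] q i = refl
coeff-⊕ (a ∷ p) [] i = sym (xor-comm (coeff (a ∷ p) i) false)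
coeff-⊕ (a ∷ p) (b ∷ q) zero = refl
coeff-⊕ (a ∷ p) (b ∷ q) (suc i) = coeff-⊕ p q i

coeff-scale : ∀ b p i → coeff (scale b p) i ≡ b ∧ coeff p i
coeff-scale b [] i = sym (∧-zeroʳ b)
coeff-scale b (a ∷ p) zero = refl
coeff-scale b (a ∷ p) (suc i) = coeff-scale b p i

⊕-isAbelianGroup : IsAbelianGroup _≋_ _⊕_ [] (λ p → p)
⊕-isAbelianGroup = record
  { isGroup = record
    { isMonoid = record
      { isSemigroup = record
        { isMagma = record
          { isEquivalence = record
            { refl = coeffs λ _ → refl
            ; sym = λ e → coeffs λ i → sym (at e i)
            ; trans = λ e f → coeffs λ i → trans (at e i) (at f i)
            }
          ; ∙-cong = λ {p} {q} {r} {s} e f → coeffs λ i →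
              trans (coeff-⊕ p r i)
                (trans (cong₂ _xor_ (at e i) (at f i)) (sym (coeff-⊕ q s i)))
          }
        ; assoc = λ p q r → coeffs λ i →
            trans (coeff-⊕ (p ⊕ q) r i)
              (trans (cong (_xor coeff r i) (coeff-⊕ p q i))
                (trans (xor-assoc (coeff p i) (coeff q i) (coeff r i))
                  (trans (cong (coeff p i xor_) (sym (coeff-⊕ q r i)))
                    (sym (coeff-⊕ p (q ⊕ r) i)))))
        }
      ; identity = (λ p → coeffs λ _ → refl)
                 , (λ p → coeffs λ i →
                     trans (coeff-⊕ p [] i) (xor-comm (coeff p i) false))
      }
    ; inverse = self , self
    ; ⁻¹-cong = λ e → e
    }
  ; comm = λ p q → coeffs λ i →
      trans (coeff-⊕ p q i)
        (trans (xor-comm (coeff p i) (coeff q i)) (sym (coeff-⊕ q p i)))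
  }
  where
  self : ∀ p → p ⊕ p ≋ []
  self p = coeffs λ i → trans (coeff-⊕ p p i) (xor-same (coeff p i))

⊕-abelianGroup : AbelianGroup 0ℓ 0ℓ
⊕-abelianGroup = record { isAbelianGroup = ⊕-isAbelianGroup }

open AbelianGroup ⊕-abelianGroup
  using (setoid; commutativeSemigroup)
  renaming (refl to ≋-refl; sym to ≋-sym; trans to ≋-trans; assoc to ⊕-assoc;
            comm to ⊕-comm; ∙-cong to ⊕-cong; identityʳ to ⊕-identityʳ; inverseʳ to ⊕-self)
open import Algebra.Properties.CommutativeSemigroup commutativeSemigroup using (interchange)
open import Relation.Binary.Reasoning.Setoid setoid

⊕-congˡ : ∀ p {q r} → q ≋ r → p ⊕ q ≋ p ⊕ r
⊕-congˡ p e = ⊕-cong (≋-refl {p}) e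

⊕-congʳ : ∀ {p q} r → p ≋ q → p ⊕ r ≋ q ⊕ r
⊕-congʳ r e = ⊕-cong e (≋-refl {r})

-- The characteristic-two cancellation behind squaring s and behind the recurrence for `E`.
⊕-telescope : ∀ p q r → (p ⊕ q) ⊕ (q ⊕ r) ≋ p ⊕ r
⊕-telescope p q r = begin
  (p ⊕ q) ⊕ (q ⊕ r)  ≈⟨ ⊕-assoc p q (q ⊕ r) ⟩
  p ⊕ (q ⊕ (q ⊕ r))  ≈⟨ ⊕-congˡ p (⊕-assoc q q r) ⟨
  p ⊕ ((q ⊕ q) ⊕ r)  ≈⟨ ⊕-congˡ p (⊕-congʳ r (⊕-self q)) ⟩
  p ⊕ r              ∎

⊕-cancelˡ : ∀ p q → p ⊕ (p ⊕ q) ≋ q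
⊕-cancelˡ p q = ⊕-telescope [] p q

⊕-cancelʳ : ∀ p q → (p ⊕ q) ⊕ q ≋ p
⊕-cancelʳ p q = begin
  (p ⊕ q) ⊕ q  ≈⟨ ⊕-assoc p q q ⟩
  p ⊕ (q ⊕ q)  ≈⟨ ⊕-congˡ p (⊕-self q) ⟩
  p ⊕ []       ≈⟨ ⊕-identityʳ p ⟩
  p            ∎

∷-cong : ∀ {a p q} → p ≋ q → a ∷ p ≋ a ∷ q
∷-cong e = coeffs λ { zero → refl ; (suc i) → at e i }

false∷[] : false ∷ [] ≋ []
false∷[] = coeffs λ { zero → refl ; (suc i) → refl }

scale-cong : ∀ a {p q} → p ≋ q → scale a p ≋ scale a q
scale-cong a {p} {q} e = coeffs λ i →
  trans (coeff-scale a p i) (trans (cong (a ∧_) (at e i)) (sym (coeff-scale a q i)))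

scale-false : ∀ p → scale false p ≋ []
scale-false p = coeffs (coeff-scale false p)

scale-true : ∀ p → scale true p ≋ p
scale-true p = coeffs (coeff-scale true p)

scale-distribˡ-⊕ : ∀ a p q → scale a (p ⊕ q) ≋ scale a p ⊕ scale a q
scale-distribˡ-⊕ a p q = coeffs λ i →
  trans (coeff-scale a (p ⊕ q) i)
    (trans (cong (a ∧_) (coeff-⊕ p q i))
      (trans (∧-distribˡ-xor a (coeff p i) (coeff q i))
        (trans (sym (cong₂ _xor_ (coeff-scale a p i) (coeff-scale a q i)))
          (sym (coeff-⊕ (scale a p) (scale a q) i)))))

scale-distribʳ-xor : ∀ a b p → scale (a xor b) p ≋ scale a p ⊕ scale b p
scale-distribʳ-xor a b p = coeffs λ i →
  trans (coeff-scale (a xor b) p i)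
    (trans (∧-distribʳ-xor (coeff p i) a b)
      (trans (sym (cong₂ _xor_ (coeff-scale a p i) (coeff-scale b p i)))
        (sym (coeff-⊕ (scale a p) (scale b p) i))))

⊗-congˡ : ∀ p {q r} → q ≋ r → p ⊗ q ≋ p ⊗ r
⊗-congˡ [] e = ≋-refl
⊗-congˡ (a ∷ p) e = ⊕-cong (scale-cong a e) (∷-cong (⊗-congˡ p e))

⊗-distribˡ-⊕ : ∀ p q r → p ⊗ (q ⊕ r) ≋ p ⊗ q ⊕ p ⊗ r
⊗-distribˡ-⊕ [] q r = ≋-refl
⊗-distribˡ-⊕ (a ∷ p) q r = begin
  scale a (q ⊕ r) ⊕ (false ∷ p ⊗ (q ⊕ r))
    ≈⟨ ⊕-cong (scale-distribˡ-⊕ a q r) (∷-cong (⊗-distribˡ-⊕ p q r)) ⟩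
  (scale a q ⊕ scale a r) ⊕ ((false ∷ p ⊗ q) ⊕ (false ∷ p ⊗ r))
    ≈⟨ interchange (scale a q) (scale a r) (false ∷ p ⊗ q) (false ∷ p ⊗ r) ⟩
  (scale a q ⊕ (false ∷ p ⊗ q)) ⊕ (scale a r ⊕ (false ∷ p ⊗ r)) ∎

⊗-zeroʳ : ∀ p → p ⊗ [] ≋ []
⊗-zeroʳ [] = ≋-refl
⊗-zeroʳ (a ∷ p) = ≋-trans (∷-cong (⊗-zeroʳ p)) false∷[]

⊗-shiftˡ : ∀ p q → (false ∷ p) ⊗ q ≋ false ∷ p ⊗ q
⊗-shiftˡ p q = ⊕-congʳ (false ∷ p ⊗ q) (scale-false q)

⊗-shiftʳ : ∀ p q → p ⊗ (false ∷ q) ≋ false ∷ p ⊗ q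
⊗-shiftʳ [] q = ≋-sym false∷[]
⊗-shiftʳ (a ∷ p) q = begin
  scale a (false ∷ q) ⊕ (false ∷ p ⊗ (false ∷ q))
    ≈⟨ ⊕-cong (scale-shift a) (∷-cong (⊗-shiftʳ p q)) ⟩
  false ∷ (scale a q ⊕ (false ∷ p ⊗ q)) ∎
  where
  scale-shift : ∀ a → scale a (false ∷ q) ≋ false ∷ scale a q
  scale-shift false = ≋-refl
  scale-shift true = ≋-refl

-- Powers of s and the recurrence for T (sⁿ).

tpow⊗R : ∀ k → tpow k ⊗ R ≋ tpow (1 + k) ⊕ tpow (2 + k)
tpow⊗R zero = coeffs λ { 0 → refl ; 1 → refl ; 2 → refl ; (suc (suc (suc i))) → refl }
tpow⊗R (suc k) = ≋-trans (⊗-shiftˡ (tpow k) R) (∷-cong (tpow⊗R k))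

Q⊗tpow : ∀ k → Q ⊗ tpow k ≋ (tpow (1 + k) ⊕ tpow (2 + k)) ⊕ (tpow (3 + k) ⊕ tpow (4 + k))
Q⊗tpow zero = coeffs λ
  { 0 → refl ; 1 → refl ; 2 → refl ; 3 → refl ; 4 → refl
  ; (suc (suc (suc (suc (suc i))))) → refl }
Q⊗tpow (suc k) = ≋-trans (⊗-shiftʳ Q (tpow k)) (∷-cong (Q⊗tpow k))

-- If a k is the image of t ^ k under a linear map, then sPow a n k is the
-- image of s ^ n t ^ k, where s = t + t².
sPow : (ℕ → Poly) → ℕ → ℕ → Poly
sPow a zero k = a k
sPow a (suc n) k = sPow a n (1 + k) ⊕ sPow a n (2 + k)

-- In characteristic two, s² = t² + t⁴.
sPow-square : ∀ a n k → sPow a (2 + n) k ≋ sPow a n (2 + k) ⊕ sPow a n (4 + k)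
sPow-square a n k = ⊕-telescope (sPow a n (2 + k)) (sPow a n (3 + k)) (sPow a n (4 + k))

-- This is T (sⁿ tᵏ). The free exponent k is what induction on n needs, since a factor s shifts it.
E : ℕ → ℕ → Poly
E = sPow C

-- The polynomial sⁿ tᵏ itself, as the image under the identity map.
G : ℕ → ℕ → Poly
G = sPow tpow

Q⊗G : ∀ n k → Q ⊗ G n k ≋ (G n (1 + k) ⊕ G n (2 + k)) ⊕ (G n (3 + k) ⊕ G n (4 + k))
Q⊗G zero k = Q⊗tpow k
Q⊗G (suc n) k = begin
  Q ⊗ (g 1 ⊕ g 2)
    ≈⟨ ⊗-distribˡ-⊕ Q (g 1) (g 2) ⟩
  Q ⊗ g 1 ⊕ Q ⊗ g 2
    ≈⟨ ⊕-cong (Q⊗G n (1 + k)) (Q⊗G n (2 + k)) ⟩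
  ((g 2 ⊕ g 3) ⊕ (g 4 ⊕ g 5)) ⊕ ((g 3 ⊕ g 4) ⊕ (g 5 ⊕ g 6))
    ≈⟨ interchange (g 2 ⊕ g 3) (g 4 ⊕ g 5) (g 3 ⊕ g 4) (g 5 ⊕ g 6) ⟩
  ((g 2 ⊕ g 3) ⊕ (g 3 ⊕ g 4)) ⊕ ((g 4 ⊕ g 5) ⊕ (g 5 ⊕ g 6)) ∎
  where
  g : ℕ → Poly
  g j = G n (j + k)

-- This is T (v f) = Q T f + s f for f = sⁿ tᵏ. For n = 0 it is the recurrence of `C` with
-- `C (3 + k)` moved across; both sides are additive in f, so it passes to s f.
T-v : ∀ n k → E n (4 + k) ⊕ E n (3 + k) ≋ Q ⊗ E n k ⊕ G (1 + n) k
T-v zero k = begin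
  (C (3 + k) ⊕ Q ⊗ C k ⊕ tpow k ⊗ R) ⊕ C (3 + k)
    ≈⟨ ⊕-comm (C (3 + k) ⊕ Q ⊗ C k ⊕ tpow k ⊗ R) (C (3 + k)) ⟩
  C (3 + k) ⊕ (C (3 + k) ⊕ Q ⊗ C k ⊕ tpow k ⊗ R)
    ≈⟨ ⊕-congˡ (C (3 + k)) (⊕-assoc (C (3 + k)) (Q ⊗ C k) (tpow k ⊗ R)) ⟩
  C (3 + k) ⊕ (C (3 + k) ⊕ (Q ⊗ C k ⊕ tpow k ⊗ R))
    ≈⟨ ⊕-cancelˡ (C (3 + k)) (Q ⊗ C k ⊕ tpow k ⊗ R) ⟩
  Q ⊗ C k ⊕ tpow k ⊗ R
    -- As a polynomial, `R` is s, so the inhomogeneous term is s tᵏ.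
    ≈⟨ ⊕-congˡ (Q ⊗ C k) (tpow⊗R k) ⟩
  Q ⊗ C k ⊕ (tpow (1 + k) ⊕ tpow (2 + k)) ∎
T-v (suc n) k = begin
  (e 5 ⊕ e 6) ⊕ (e 4 ⊕ e 5)
    ≈⟨ interchange (e 5) (e 6) (e 4) (e 5) ⟩
  (e 5 ⊕ e 4) ⊕ (e 6 ⊕ e 5)
    ≈⟨ ⊕-cong (T-v n (1 + k)) (T-v n (2 + k)) ⟩
  (Q ⊗ e 1 ⊕ G (1 + n) (1 + k)) ⊕ (Q ⊗ e 2 ⊕ G (1 + n) (2 + k))
    ≈⟨ interchange (Q ⊗ e 1) (G (1 + n) (1 + k)) (Q ⊗ e 2) (G (1 + n) (2 + k)) ⟩
  (Q ⊗ e 1 ⊕ Q ⊗ e 2) ⊕ G (2 + n) k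
    ≈⟨ ⊕-congʳ (G (2 + n) k) (⊗-distribˡ-⊕ Q (e 1) (e 2)) ⟨
  Q ⊗ (e 1 ⊕ e 2) ⊕ G (2 + n) k ∎
  where
  e : ℕ → Poly
  e j = E n (j + k)

-- Since v = s t², the left side is T (v f) with f = sⁿ⁺¹ tᵏ.
T-sv : ∀ n k → E (2 + n) (2 + k) ≋ Q ⊗ E (1 + n) k ⊕ G (2 + n) k
T-sv n k = begin
  (e 4 ⊕ e 5) ⊕ (e 5 ⊕ e 6)  ≈⟨ ⊕-comm (e 4 ⊕ e 5) (e 5 ⊕ e 6) ⟩
  (e 5 ⊕ e 6) ⊕ (e 4 ⊕ e 5)  ≈⟨ T-v (1 + n) k ⟩
  Q ⊗ E (1 + n) k ⊕ G (2 + n) k ∎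
  where
  e : ℕ → Poly
  e j = E n (j + k)

-- Since v² = s² t⁴, applying `T-v` twice to f = sⁿ tᵏ gives Q² T f + (Q + v) s f, and Q + v = s.
T-vv : ∀ n k → E (2 + n) (4 + k) ≋ Q ⊗ (Q ⊗ E n k) ⊕ G (2 + n) k
T-vv n k = begin
  (e 6 ⊕ e 7) ⊕ (e 7 ⊕ e 8)
    ≈⟨ ⊕-cong (⊕-comm (e 6) (e 7)) (⊕-comm (e 7) (e 8)) ⟩
  (e 7 ⊕ e 6) ⊕ (e 8 ⊕ e 7)
    ≈⟨ ⊕-cong (T-v n (3 + k)) (T-v n (4 + k)) ⟩
  (Q ⊗ e 3 ⊕ g 3) ⊕ (Q ⊗ e 4 ⊕ g 4)
    ≈⟨ interchange (Q ⊗ e 3) (g 3) (Q ⊗ e 4) (g 4) ⟩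
  (Q ⊗ e 3 ⊕ Q ⊗ e 4) ⊕ (g 3 ⊕ g 4)
    ≈⟨ ⊕-congʳ (g 3 ⊕ g 4) (⊗-distribˡ-⊕ Q (e 3) (e 4)) ⟨
  Q ⊗ (e 3 ⊕ e 4) ⊕ (g 3 ⊕ g 4)
    ≈⟨ ⊕-congʳ (g 3 ⊕ g 4) (⊗-congˡ Q (≋-trans (⊕-comm (e 3) (e 4)) (T-v n k))) ⟩
  Q ⊗ (Q ⊗ e 0 ⊕ g 0) ⊕ (g 3 ⊕ g 4)
    ≈⟨ ⊕-congʳ (g 3 ⊕ g 4) (⊗-distribˡ-⊕ Q (Q ⊗ e 0) (g 0)) ⟩
  (Q ⊗ (Q ⊗ e 0) ⊕ Q ⊗ g 0) ⊕ (g 3 ⊕ g 4)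
    ≈⟨ ⊕-assoc (Q ⊗ (Q ⊗ e 0)) (Q ⊗ g 0) (g 3 ⊕ g 4) ⟩
  Q ⊗ (Q ⊗ e 0) ⊕ (Q ⊗ g 0 ⊕ (g 3 ⊕ g 4))
    ≈⟨ ⊕-congˡ (Q ⊗ (Q ⊗ e 0)) (⊕-congʳ (g 3 ⊕ g 4) (Q⊗G (1 + n) k)) ⟩
  Q ⊗ (Q ⊗ e 0) ⊕ (((g 1 ⊕ g 2) ⊕ (g 3 ⊕ g 4)) ⊕ (g 3 ⊕ g 4))
    ≈⟨ ⊕-congˡ (Q ⊗ (Q ⊗ e 0)) (⊕-cancelʳ (g 1 ⊕ g 2) (g 3 ⊕ g 4)) ⟩
  Q ⊗ (Q ⊗ e 0) ⊕ (g 1 ⊕ g 2) ∎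
  where
  e g : ℕ → Poly
  e j = E n (j + k)
  g j = G (1 + n) (j + k)

-- Splitting s⁴ = s v + v² produces the polynomial term s² f twice, so it cancels and a homogeneous
-- recurrence remains.
E-rec : ∀ n k → E (4 + n) k ≋ Q ⊗ E (1 + n) k ⊕ Q ⊗ (Q ⊗ E n k)
E-rec n k = begin
  E (4 + n) k
    ≈⟨ sPow-square C (2 + n) k ⟩
  E (2 + n) (2 + k) ⊕ E (2 + n) (4 + k)
    ≈⟨ ⊕-cong (T-sv n k) (≋-trans (T-vv n k) (⊕-comm (Q ⊗ (Q ⊗ E n k)) (G (2 + n) k))) ⟩
  (Q ⊗ E (1 + n) k ⊕ G (2 + n) k) ⊕ (G (2 + n) k ⊕ Q ⊗ (Q ⊗ E n k))
    ≈⟨ ⊕-telescope (Q ⊗ E (1 + n) k) (G (2 + n) k) (Q ⊗ (Q ⊗ E n k)) ⟩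
  Q ⊗ E (1 + n) k ⊕ Q ⊗ (Q ⊗ E n k) ∎

-- Spans of finitely many members of a family.

data Span (v : ℕ → Poly) (n : ℕ) : Poly → Set where
  gen  : ∀ {k} → k < n → Span v n (v k)
  zero : Span v n []
  add  : ∀ {p q} → Span v n p → Span v n q → Span v n (p ⊕ q)
  resp : ∀ {p q} → p ≋ q → Span v n p → Span v n q

Span-map : ∀ {v w m n} (f : Poly → Poly) →
  (∀ {p q} → p ≋ q → f p ≋ f q) → f [] ≋ [] → (∀ p q → f (p ⊕ q) ≋ f p ⊕ f q) →
  (∀ {k} → k < m → Span w n (f (v k))) → ∀ {p} → Span v m p → Span w n (f p)
Span-map f f-cong f-zero f-add f-gen (gen k<m) = f-gen k<m
Span-map f f-cong f-zero f-add f-gen zero = resp (≋-sym f-zero) zero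
Span-map f f-cong f-zero f-add f-gen (add {p} {q} x y) =
  resp (≋-sym (f-add p q))
    (add (Span-map f f-cong f-zero f-add f-gen x) (Span-map f f-cong f-zero f-add f-gen y))
Span-map f f-cong f-zero f-add f-gen (resp e x) =
  resp (f-cong e) (Span-map f f-cong f-zero f-add f-gen x)

Span-⊆ : ∀ {v w m n} → (∀ {k} → k < m → Span w n (v k)) → ∀ {p} → Span v m p → Span w n p
Span-⊆ = Span-map (λ p → p) (λ e → e) ≋-refl (λ _ _ → ≋-refl)

Span-≤ : ∀ {v m n} → m ≤ n → ∀ {p} → Span v m p → Span v n p
Span-≤ m≤n = Span-⊆ λ k<m → gen (≤-trans k<m m≤n)

-- Subtraction is addition here, so "leading term plus lower terms" is stated as membership of a sum
-- and can be solved for either summand.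
Span-transfer : ∀ {v n p q} → Span v n (p ⊕ q) → Span v n p → Span v n q
Span-transfer {p = p} {q} x y = resp (⊕-cancelˡ p q) (add y x)

-- The family `F j`, which is (1 + t) Qʲ, and its relation to T (sⁿ).

F : ℕ → Poly
F zero = E 1 0
F (suc j) = Q ⊗ F j

Q⊗-Span : ∀ {m p} → Span F m p → Span F (1 + m) (Q ⊗ p)
Q⊗-Span = Span-map (Q ⊗_) (⊗-congˡ Q) (⊗-zeroʳ Q) (⊗-distribˡ-⊕ Q) (λ k<m → gen (s≤s k<m))

-- The two copies of `C 3` cancel, and `C 4` and `C 2` both equal t. The order-four recurrence takes
-- its initial values from here, from `E-3-0` and from n = 0, 1.
E-2-0 : E 2 0 ≋ []
E-2-0 = coeffs λ { 0 → refl ; 1 → refl ; 2 → refl ; 3 → refl ; 4 → refl ; 5 → refl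
  ; (suc (suc (suc (suc (suc (suc i)))))) → refl }

E-3-0 : E 3 0 ≋ F 1
E-3-0 = coeffs λ { 0 → refl ; 1 → refl ; 2 → refl ; 3 → refl ; 4 → refl ; 5 → refl ; 6 → refl
  ; 7 → refl ; 8 → refl ; 9 → refl
  ; (suc (suc (suc (suc (suc (suc (suc (suc (suc (suc i)))))))))) → refl }

-- Joint induction with `E-odd`: `E-rec` lowers the index by three and by four, so it mixes the two
-- parities.
E-even : ∀ m → Span F m (E (m * 2) 0)
E-odd : ∀ m → Span F m (F m ⊕ E (1 + m * 2) 0)

E-odd′ : ∀ m → Span F (1 + m) (E (1 + m * 2) 0)
E-odd′ m = Span-transfer (Span-≤ (m≤n⇒m≤1+n ≤-refl) (E-odd m)) (gen ≤-refl)

E-even 0 = zero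
E-even 1 = resp (≋-sym E-2-0) zero
E-even (suc (suc m)) = resp (≋-sym (E-rec (m * 2) 0))
  (add (Q⊗-Span (E-odd′ m)) (Q⊗-Span (Q⊗-Span (E-even m))))

E-odd 0 = resp (≋-sym (⊕-self (F 0))) zero
E-odd 1 = resp (≋-sym (≋-trans (⊕-congˡ (F 1) E-3-0) (⊕-self (F 1)))) zero
E-odd (suc (suc m)) =
  -- The leading `F (2 + m)` is Q² times `F m`; the even-index term contributes only `F j` with j <
  -- 2 + m.
  resp eq (add (Q⊗-Span (E-even (suc m))) (Q⊗-Span (Q⊗-Span (E-odd m))))
  where
  e₁ e₂ : Poly
  e₁ = E (1 + m * 2) 0
  e₂ = E (2 + m * 2) 0
  eq : Q ⊗ e₂ ⊕ Q ⊗ (Q ⊗ (F m ⊕ e₁)) ≋ F (2 + m) ⊕ E (5 + m * 2) 0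
  eq = begin
    Q ⊗ e₂ ⊕ Q ⊗ (Q ⊗ (F m ⊕ e₁))
      ≈⟨ ⊕-congˡ (Q ⊗ e₂) (≋-trans (⊗-congˡ Q (⊗-distribˡ-⊕ Q (F m) e₁))
                                   (⊗-distribˡ-⊕ Q (Q ⊗ F m) (Q ⊗ e₁))) ⟩
    Q ⊗ e₂ ⊕ (F (2 + m) ⊕ Q ⊗ (Q ⊗ e₁))
      ≈⟨ ⊕-assoc (Q ⊗ e₂) (F (2 + m)) (Q ⊗ (Q ⊗ e₁)) ⟨
    (Q ⊗ e₂ ⊕ F (2 + m)) ⊕ Q ⊗ (Q ⊗ e₁)
      ≈⟨ ⊕-congʳ (Q ⊗ (Q ⊗ e₁)) (⊕-comm (Q ⊗ e₂) (F (2 + m))) ⟩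
    (F (2 + m) ⊕ Q ⊗ e₂) ⊕ Q ⊗ (Q ⊗ e₁)
      ≈⟨ ⊕-assoc (F (2 + m)) (Q ⊗ e₂) (Q ⊗ (Q ⊗ e₁)) ⟩
    F (2 + m) ⊕ (Q ⊗ e₂ ⊕ Q ⊗ (Q ⊗ e₁))
      ≈⟨ ⊕-congˡ (F (2 + m)) (E-rec (1 + m * 2) 0) ⟨
    F (2 + m) ⊕ E (5 + m * 2) 0 ∎

-- Triangular passage from `F` to `oddE` and from there to `C`.

oddE : ℕ → Poly
oddE j = E (1 + j * 2) 0

-- By `E-odd` the change of family is triangular with ones on the diagonal, so it can be inverted
-- recursively.
F∈oddE : ∀ m {j} → j < m → Span oddE m (F j)
F∈oddE (suc m) {j} (s≤s j≤m) with m≤n⇒m<n∨m≡n j≤m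
... | inj₁ j<m = Span-≤ (m≤n⇒m≤1+n ≤-refl) (F∈oddE m j<m)
... | inj₂ refl = Span-transfer
  (resp (⊕-comm (F m) (oddE m))
    (Span-≤ (m≤n⇒m≤1+n ≤-refl) (Span-⊆ (F∈oddE m) (E-odd m))))
  (gen ≤-refl)

-- The polynomial sⁿ tᵏ is monic of degree 2 n + k, and T sends each power of t to the corresponding
-- `C`.
E-leading : ∀ n k → Span C (n * 2 + k) (E n k ⊕ C (n * 2 + k))
E-leading zero k = resp (≋-sym (⊕-self (C k))) zero
E-leading (suc n) k =
  resp (≋-sym (⊕-assoc (E n (1 + k)) (E n (2 + k)) (C (2 + (n * 2 + k)))))
    (add low
      (subst (λ i → Span C i (E n (2 + k) ⊕ C i)) (index₂ (n * 2)) (E-leading n (2 + k))))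
  where
  index₁ : ∀ i → i + (1 + k) ≡ 1 + (i + k)
  index₁ i = +-suc i k
  index₂ : ∀ i → i + (2 + k) ≡ 2 + (i + k)
  index₂ i = trans (+-suc i (1 + k)) (cong suc (+-suc i k))
  -- The degree of sⁿ tᵏ⁺¹ is 2 n + k + 1, just below the bound, so its leading `C` is also an
  -- admissible generator.
  low : Span C (2 + (n * 2 + k)) (E n (1 + k))
  low = Span-transfer
    (resp (⊕-comm (E n (1 + k)) (C (1 + (n * 2 + k))))
      (Span-≤ (m≤n⇒m≤1+n ≤-refl)
        (subst (λ i → Span C i (E n (1 + k) ⊕ C i)) (index₁ (n * 2)) (E-leading n (1 + k)))))
    (gen ≤-refl)

E-leading₀ : ∀ n → Span C (n * 2) (E n 0 ⊕ C (n * 2))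
E-leading₀ n = subst (λ i → Span C i (E n 0 ⊕ C i)) (+-identityʳ (n * 2)) (E-leading n 0)

-- The largest index occurring is 2 (2 j + 1) = 4 j + 2, which is below 4 (j + 1) ≤ 4 m.
oddE∈C : ∀ {m j} → j < m → Span C (m * 2 * 2) (oddE j)
oddE∈C {m} {j} j<m = Span-≤ (*-monoˡ-≤ 2 (*-monoˡ-≤ 2 j<m))
  (Span-≤ (m≤n⇒m≤1+n ≤-refl)
    (Span-transfer
      (resp (⊕-comm (oddE j) (C ((1 + j * 2) * 2))) (Span-≤ (m≤n⇒m≤1+n ≤-refl) (E-leading₀ (1 + j * 2))))
      (gen ≤-refl)))

C∈lower : ∀ m → Span C (m * 2 * 2) (C (m * 2 * 2))
C∈lower m = Span-transfer (E-leading₀ (m * 2))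
  (Span-⊆ oddE∈C (Span-⊆ (F∈oddE m) (E-even m)))

-- Explicit coefficients for members of a span.

linComb-xor : ∀ c d n → linComb (λ k → c k xor d k) n ≋ linComb c n ⊕ linComb d n
linComb-xor c d zero = ≋-refl
linComb-xor c d (suc n) = begin
  linComb (λ k → c k xor d k) n ⊕ scale (c n xor d n) (C n)
    ≈⟨ ⊕-cong (linComb-xor c d n) (scale-distribʳ-xor (c n) (d n) (C n)) ⟩
  (linComb c n ⊕ linComb d n) ⊕ (scale (c n) (C n) ⊕ scale (d n) (C n))
    ≈⟨ interchange (linComb c n) (linComb d n) (scale (c n) (C n)) (scale (d n) (C n)) ⟩
  (linComb c n ⊕ scale (c n) (C n)) ⊕ (linComb d n ⊕ scale (d n) (C n)) ∎

linComb-zero : ∀ c n → (∀ {k} → k < n → c k ≡ false) → linComb c n ≋ []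
linComb-zero c zero _ = ≋-refl
linComb-zero c (suc n) c≡false rewrite c≡false {n} ≤-refl =
  ⊕-cong (linComb-zero c n λ k<n → c≡false (m≤n⇒m≤1+n k<n)) (scale-false (C n))

≡ᵇ-refl : ∀ n → (n ≡ᵇ n) ≡ true
≡ᵇ-refl zero = refl
≡ᵇ-refl (suc n) = ≡ᵇ-refl n

<⇒≡ᵇ-false : ∀ {m n} → m < n → (m ≡ᵇ n) ≡ false
<⇒≡ᵇ-false {zero} (s≤s _) = refl
<⇒≡ᵇ-false {suc m} (s≤s m<n) = <⇒≡ᵇ-false m<n

>⇒≡ᵇ-false : ∀ {m n} → n < m → (m ≡ᵇ n) ≡ false
>⇒≡ᵇ-false {n = zero} (s≤s _) = refl
>⇒≡ᵇ-false {n = suc n} (s≤s n<m) = >⇒≡ᵇ-false n<m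

-- Terms with index above k are peeled off from the top; once k is the last index, all earlier terms
-- vanish.
linComb-indicator : ∀ {k n} → k < n → linComb (_≡ᵇ k) n ≋ C k
linComb-indicator {k} {suc n} (s≤s k≤n) with m≤n⇒m<n∨m≡n k≤n
... | inj₁ k<n rewrite >⇒≡ᵇ-false k<n =
  ≋-trans (⊕-cong (linComb-indicator k<n) (scale-false (C n))) (⊕-identityʳ (C k))
... | inj₂ refl rewrite ≡ᵇ-refl n =
  ⊕-cong (linComb-zero (_≡ᵇ n) n <⇒≡ᵇ-false) (scale-true (C n))

-- Generators get indicator functions as coefficients, and sums get pointwise `xor`.
Span⇒linComb : ∀ {n p} → Span C n p → ∃ λ c → p ≋ linComb c n
Span⇒linComb (gen {k} k<n) = (_≡ᵇ k) , ≋-sym (linComb-indicator k<n)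
Span⇒linComb {n} zero = (λ _ → false) , ≋-sym (linComb-zero _ n λ _ → refl)
Span⇒linComb {n} (add x y) with Span⇒linComb x | Span⇒linComb y
... | c , p≋ | d , q≋ =
  (λ k → c k xor d k) , ≋-trans (⊕-cong p≋ q≋) (≋-sym (linComb-xor c d n))
Span⇒linComb (resp e x) with Span⇒linComb x
... | c , p≋ = c , ≋-trans (≋-sym e) p≋

theorem2p10 : ∀ (m : ℕ) → ∃ λ (c : ℕ → Bool) → C (4 * m) ≈ₚ linComb c (4 * m)
theorem2p10 m with Span⇒linComb (subst (λ n → Span C n (C n)) m*2*2≡4*m (C∈lower m))
  where
  m*2*2≡4*m : m * 2 * 2 ≡ 4 * m
  m*2*2≡4*m = trans (*-assoc m 2 2) (*-comm m 4)
... | c , e = c , at e
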